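{- For every $\varepsilon>0$ there is $n_0$ such that every triangle-free graph on $n\ge n_0$ vertices has list chromatic number at most $(2\sqrt{2}+\varepsilon)\sqrt{n}$. -}

module Defs where

open import Data.Nat using (ℕ; _≤_)
open import Data.Integer using (+_)
open import Data.Fin using (Fin)
open import Data.Bool using (Bool; true; false)
open import Data.List using (List; length)
open import Data.List.Membership.Propositional using (_∈_)
open import Data.List.Relation.Unary.Unique.Propositional using (Unique)
open import Data.Product using (Σ; _×_; ∃)
open import Data.Sum using (_⊎_)
open import Relation.Binary.PropositionalEquality using (_≡_; _≢_)
open import Relation.Nullary using (¬_)
open import Data.Rational as ℚ using (ℚ; _/_)

record Graph (n : ℕ) : Set where
  field
    adj       : Fin n → Fin n → Bool
    adj-sym   : ∀ u v → adj u v ≡ adj v u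
    adj-irrefl : ∀ v → adj v v ≡ false
open Graph public

TriangleFree : ∀ {n} → Graph n → Set
TriangleFree {n} G =
  ¬ (Σ (Fin n) λ u → Σ (Fin n) λ v → Σ (Fin n) λ w →
       (adj G u v ≡ true) × (adj G v w ≡ true) × (adj G u w ≡ true))

ListAssignment : ℕ → Set
ListAssignment n = Fin n → List ℕ

IsKAssignment : ∀ {n} → ℕ → ListAssignment n → Set
IsKAssignment k L = ∀ v → Unique (L v) × (k ≤ length (L v))

ProperLColouring : ∀ {n} → Graph n → ListAssignment n → (Fin n → ℕ) → Set
ProperLColouring G L c =
  (∀ v → c v ∈ L v) × (∀ u v → adj G u v ≡ true → c u ≢ c v)

-- G is k-choosable: every assignment of lists of size ≥ k admits a proper L-colouring.
-- The list chromatic number of G is ≤ k iff G is k-choosable.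
Choosable : ∀ {n} → Graph n → ℕ → Set
Choosable G k = ∀ L → IsKAssignment k L → ∃ λ c → ProperLColouring G L c

ℕtoℚ : ℕ → ℚ
ℕtoℚ m = (+ m) / 1

sq : ℚ → ℚ
sq x = x ℚ.* x

-- For ε > 0 (rational), k ≤ (2√2 + ε)·√n, expressed in rational arithmetic.
-- With t = k/√n ≥ 0:  t ≤ 2√2+ε  ⇔  t ≤ ε  ∨  (t-ε)² ≤ 8
--   ⇔ t² ≤ ε²  ∨  t²+ε²-8 ≤ 0  ∨  (t²+ε²-8)² ≤ 4ε²t²,
-- and multiplying through by n (resp. n²) gives the disjuncts below
-- (for n = 0 each disjunct forces k = 0, matching k ≤ 0).
BoundedBy2√2PlusEpsSqrt : ℚ → ℕ → ℕ → Set
BoundedBy2√2PlusEpsSqrt ε n k =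
  let K = sq (ℕtoℚ k)
      N = ℕtoℚ n
      D = K ℚ.+ ((sq ε ℚ.- ℕtoℚ 8) ℚ.* N)
  in (K ℚ.≤ sq ε ℚ.* N)
     ⊎ (D ℚ.≤ ℚ.0ℚ)
     ⊎ (sq D ℚ.≤ ℕtoℚ 4 ℚ.* sq ε ℚ.* K ℚ.* N)

{-# OPTIONS --safe #-}

-- Let d ≈ √(n/2).  As long as some vertex v has more than d uncoloured
-- neighbours whose lists contain a common colour c, give them all the colour c
-- (they are independent, as there are no triangles) and delete c from every
-- other list.  This happens at most n/(d+1) ≈ √(2n) times.  Afterwards every
-- colour has degree at most d around every vertex, and Haxell's theorem on
-- independent transversals colours the rest from lists of size > 2d.  Lists of
-- size 2d + n/d ≈ 2√2 √n therefore suffice.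
--
-- Haxell's theorem (a class without a representative either can be added to the
-- transversal or lies in a family of s + 1 classes totally dominated by 2s
-- vertices) is proved by restoring one at a time the edges at the class A still
-- to be represented.  If the edge xy spoils the transversal, delete the neighbours
-- of x and y and merge the class of y into A: a transversal of the smaller
-- instance extends by x or by y, and a dominating set grows by {x, y}.

module Submission where

open import Defs
open import Data.Nat using (ℕ; _≥_)
open import Data.Product using (Σ; _×_)

open import Level using (0ℓ)
open import Data.Bool using (true; false)
import Data.Bool.Properties as Bool
open import Data.Fin using (Fin)
import Data.Fin.Properties as Fin
open import Data.Integer as ℤ using (+_; +[1+_])
import Data.Integer.Properties as ℤ
open import Data.List
  using (List; []; _∷_; length; allFin; cartesianProduct; concatMap; filter; map)
open import Data.List.Membership.Propositional using (_∈_; _∉_; find; lose)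
open import Data.List.Membership.Propositional.Properties
  using (∈-filter⁺; ∈-filter⁻; ∈-concatMap⁺; ∈-concatMap⁻; ∈-map⁺; ∈-map⁻
        ; ∈-allFin; ∈-cartesianProduct⁺)
open import Data.List.Properties
  using (filter-notAll; length-filter; length-++; length-map; length-tabulate)
open import Data.List.Relation.Binary.Disjoint.Propositional using (Disjoint)
open import Data.List.Relation.Binary.Subset.Propositional using (_⊆_)
open import Data.List.Relation.Unary.All as All using (_∷_)
import Data.List.Relation.Unary.All.Properties as All
open import Data.List.Relation.Unary.AllPairs as AllPairs using ([]; _∷_)
import Data.List.Relation.Unary.AllPairs.Properties as AllPairs
open import Data.List.Relation.Unary.Any as Any using (Any; here; there; any?)
open import Data.List.Relation.Unary.Unique.Propositional using (Unique)
import Data.List.Relation.Unary.Unique.Propositional.Properties as Unique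
open import Data.Nat as ℕ using (zero; suc; z≤n; s≤s)
import Data.Nat.Coprimality as Coprime
import Data.Nat.Properties as ℕ
open import Data.Nat.Tactic.RingSolver using (solve-∀)
open import Data.Product using (∃; _,_; proj₁; proj₂)
open import Data.Product.Properties using (≡-dec)
import Data.Rational.Properties as ℚ
open import Data.Rational.Solver using (module +-*-Solver)
import Data.Rational.Unnormalised as ℚᵘ
import Data.Rational.Unnormalised.Properties as ℚᵘ
open import Data.Sum as Sum using (_⊎_; inj₁; inj₂)
open import Function using (_∘_)
open import Relation.Binary.Core using (Rel)
open import Relation.Binary.Definitions using (Decidable; DecidableEquality; Symmetric)
open import Relation.Binary.PropositionalEquality
  using (_≡_; _≢_; refl; sym; trans; cong; cong₂; subst; ≢-sym)
open import Relation.Nullary using (¬_; yes; no; contradiction; ¬?; _×-dec_; does)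
open import Relation.Unary as Unary using (Pred)

-- Haxell's theorem on independent transversals.

record IsTransversal {V C : Set} (κ : V → C) (W : List V) (R : Rel V 0ℓ)
  (Cs : List C) (t : C → V) : Set where
  field
    ∈W    : ∀ {c} → c ∈ Cs → t c ∈ W
    class : ∀ {c} → c ∈ Cs → κ (t c) ≡ c
    indep : ∀ {c c′} → c ∈ Cs → c′ ∈ Cs → c ≢ c′ → ¬ R (t c) (t c′)

module Transversals {V C : Set}
  (_≟ᵛ_ : DecidableEquality V) (_≟_ : DecidableEquality C) (A : C) where

  open import Data.Nat using (_*_; _≤_; _<_)
  open import Data.List.Membership.DecPropositional _≟_ using (_∈?_)

  -- `A` is kept apart from `S`, so `2 * length S` is Haxell's bound 2(k - 1) for a family of k
  -- classes. Domination is total: vertices of `Z` in these classes need neighbours in `Z` too.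
  record Dominated (κ : V → C) (W : List V) (R : Rel V 0ℓ) (Cs : List C) : Set where
    field
      S         : List C
      Z         : List V
      S⊆Cs      : S ⊆ Cs
      unique    : Unique S
      Z-small   : length Z ≤ 2 * length S
      dominates : ∀ {v} → v ∈ W → κ v ∈ A ∷ S → Any (R v) Z

  Dominated-mono : ∀ {κ W Cs} {R R′ : Rel V 0ℓ} → (∀ {u v} → R u v → R′ u v) →
    Dominated κ W R Cs → Dominated κ W R′ Cs
  Dominated-mono R⇒R′ d = record
    { S = S ; Z = Z ; S⊆Cs = S⊆Cs ; unique = unique ; Z-small = Z-small
    ; dominates = λ v∈W κv∈S → Any.map R⇒R′ (dominates v∈W κv∈S) }
    where open Dominated d

  update : (C → V) → C → V → C → V
  update t c v c′ with c′ ≟ c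
  ... | yes _ = v
  ... | no  _ = t c′

  extend : ∀ {κ W R Cs t} c v → Symmetric R → v ∈ W → κ v ≡ c →
    (∀ {c′} → c′ ∈ Cs → c′ ≢ c → ¬ R v (t c′)) →
    IsTransversal κ W R Cs t → IsTransversal κ W R (c ∷ Cs) (update t c v)
  extend {κ} {W} {R} {Cs} {t} c v R-sym v∈W κv≡c ¬R it = record
    { ∈W = ∈W′ ; class = class′ ; indep = indep′ }
    where
    open IsTransversal it
    tail : ∀ {c′} → c′ ∈ c ∷ Cs → c′ ≢ c → c′ ∈ Cs
    tail (here eq) c′≢c = contradiction eq c′≢c
    tail (there p) _    = p
    ∈W′ : ∀ {c′} → c′ ∈ c ∷ Cs → update t c v c′ ∈ W
    ∈W′ {c′} p with c′ ≟ c
    ... | yes _    = v∈W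
    ... | no  c′≢c = ∈W (tail p c′≢c)
    class′ : ∀ {c′} → c′ ∈ c ∷ Cs → κ (update t c v c′) ≡ c′
    class′ {c′} p with c′ ≟ c
    ... | yes refl = κv≡c
    ... | no  c′≢c = class (tail p c′≢c)
    indep′ : ∀ {c₁ c₂} → c₁ ∈ c ∷ Cs → c₂ ∈ c ∷ Cs → c₁ ≢ c₂ →
      ¬ R (update t c v c₁) (update t c v c₂)
    indep′ {c₁} {c₂} p q c₁≢c₂ with c₁ ≟ c | c₂ ≟ c
    ... | yes refl | yes refl = contradiction refl c₁≢c₂
    ... | yes _    | no  c₂≢c = ¬R (tail q c₂≢c) c₂≢c
    ... | no  c₁≢c | yes _    = ¬R (tail p c₁≢c) c₁≢c ∘ R-sym
    ... | no  c₁≢c | no  c₂≢c = indep (tail p c₁≢c) (tail q c₂≢c) c₁≢c₂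

  restrict : ∀ {κ : V → C} {W R Cs Cs′ t} → Cs′ ⊆ Cs →
    IsTransversal κ W R Cs t → IsTransversal κ W R Cs′ t
  restrict Cs′⊆Cs it = record
    { ∈W = ∈W ∘ Cs′⊆Cs ; class = class ∘ Cs′⊆Cs ; indep = λ p q → indep (Cs′⊆Cs p) (Cs′⊆Cs q) }
    where open IsTransversal it

  -- Both orientations of the edge go, so that the relation stays symmetric.
  _∖[_,_] : Rel V 0ℓ → V → V → Rel V 0ℓ
  (R ∖[ x , y ]) u v = R u v × ¬ (u ≡ x × v ≡ y) × ¬ (u ≡ y × v ≡ x)

  ∖-dec : ∀ {R} → Decidable R → ∀ x y → Decidable (R ∖[ x , y ])
  ∖-dec R? x y u v =
    R? u v ×-dec ¬? (u ≟ᵛ x ×-dec v ≟ᵛ y) ×-dec ¬? (u ≟ᵛ y ×-dec v ≟ᵛ x)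

  ∖-sym : ∀ {R x y} → Symmetric R → Symmetric (R ∖[ x , y ])
  ∖-sym R-sym (r , ≢xy , ≢yx) = R-sym r , (λ (p , q) → ≢yx (q , p)) , (λ (p , q) → ≢xy (q , p))

  Outcome : (κ : V → C) (W : List V) (R : Rel V 0ℓ) (Cs : List C) → Set
  Outcome κ W R Cs = ∃ (IsTransversal κ W R (A ∷ Cs)) ⊎ Dominated κ W R Cs

  -- The induction is on the number of classes. Labelling, vertex set and relation are quantified
  -- inside because merging two classes changes the first two.
  HaxellFor : ℕ → Set₁
  HaxellFor m = ∀ {κ : V → C} {W R Cs t} → length Cs < m → A ∉ Cs → Symmetric R → Decidable R →
    IsTransversal κ W R Cs t → Outcome κ W R Cs

  module Merge {κ : V → C} {W : List V} {R : Rel V 0ℓ} {Cs : List C}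
    (A∉Cs : A ∉ Cs) (R-sym : Symmetric R) (R? : Decidable R)
    {x y : V} (x∈W : x ∈ W) (y∈W : y ∈ W) (κx≡A : κ x ≡ A) (κy∈Cs : κ y ∈ Cs) where

    ≢κy? = λ c → ¬? (c ≟ κ y)
    far? = λ v → ¬? (R? v x) ×-dec ¬? (R? v y)

    Cs′ : List C
    Cs′ = filter ≢κy? Cs

    W′ : List V
    W′ = filter far? W

    κ′ : V → C
    κ′ v with κ v ≟ κ y
    ... | yes _ = A
    ... | no  _ = κ v

    κ′-≢ : ∀ {v} → κ v ≢ κ y → κ′ v ≡ κ v
    κ′-≢ {v} neq with κ v ≟ κ y
    ... | yes eq = contradiction eq neq
    ... | no _   = refl

    Cs′⊆Cs : Cs′ ⊆ Cs
    Cs′⊆Cs = proj₁ ∘ ∈-filter⁻ ≢κy? {xs = Cs}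

    Cs′-shorter : length Cs′ < length Cs
    Cs′-shorter = filter-notAll ≢κy? Cs (Any.map (λ eq neq → neq (sym eq)) κy∈Cs)

    A∉Cs′ : A ∉ Cs′
    A∉Cs′ = A∉Cs ∘ Cs′⊆Cs

    ≢A : ∀ {c} → c ∈ Cs′ → c ≢ A
    ≢A c∈ refl = A∉Cs′ c∈

    ∈Cs′⇒≢ : ∀ {c} → c ∈ Cs′ → c ≢ κ y
    ∈Cs′⇒≢ = proj₂ ∘ ∈-filter⁻ ≢κy? {xs = Cs}

    W′⊆W : W′ ⊆ W
    W′⊆W = proj₁ ∘ ∈-filter⁻ far? {xs = W}

    far : ∀ {v} → v ∈ W′ → ¬ R v x × ¬ R v y
    far = proj₂ ∘ ∈-filter⁻ far? {xs = W}

    -- `x` and `y` are themselves in the transversal, and the deleted edge joins only these two.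
    -- Hence the representatives of all other classes are adjacent to neither and survive in `W′`.
    merged-transversal : ∀ {t} → IsTransversal κ W (R ∖[ x , y ]) (A ∷ Cs) t →
      t A ≡ x → t (κ y) ≡ y → IsTransversal κ′ W′ R Cs′ t
    merged-transversal {t} it tA≡x ty≡y = record { ∈W = ∈W′ ; class = class′ ; indep = indep′ }
      where
      open IsTransversal it
      t≢x : ∀ {c} → c ∈ Cs′ → t c ≢ x
      t≢x c∈ eq = ≢A c∈ (trans (sym (class (there (Cs′⊆Cs c∈)))) (trans (cong κ eq) κx≡A))
      t≢y : ∀ {c} → c ∈ Cs′ → t c ≢ y
      t≢y c∈ eq = ∈Cs′⇒≢ c∈ (trans (sym (class (there (Cs′⊆Cs c∈)))) (cong κ eq))
      ¬R : ∀ {c} → c ∈ Cs′ → ∀ {c′} → c′ ∈ A ∷ Cs → c ≢ c′ → ¬ R (t c) (t c′)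
      ¬R c∈ c′∈ c≢c′ r = indep (there (Cs′⊆Cs c∈)) c′∈ c≢c′
        (r , t≢x c∈ ∘ proj₁ , t≢y c∈ ∘ proj₁)
      ∈W′ : ∀ {c} → c ∈ Cs′ → t c ∈ W′
      ∈W′ c∈ = ∈-filter⁺ far? (∈W (there (Cs′⊆Cs c∈)))
        ( subst (¬_ ∘ R _) tA≡x (¬R c∈ (here refl) (≢A c∈))
        , subst (¬_ ∘ R _) ty≡y (¬R c∈ (there κy∈Cs) (∈Cs′⇒≢ c∈)))
      class′ : ∀ {c} → c ∈ Cs′ → κ′ (t c) ≡ c
      class′ c∈ = trans (κ′-≢ (subst (_≢ κ y) (sym eq) (∈Cs′⇒≢ c∈))) eq
        where eq = class (there (Cs′⊆Cs c∈))
      indep′ : ∀ {c c′} → c ∈ Cs′ → c′ ∈ Cs′ → c ≢ c′ → ¬ R (t c) (t c′)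
      indep′ c∈ c′∈ = ¬R c∈ (there (Cs′⊆Cs c′∈))

    -- The vertex chosen from the merged class lies in one of the two original
    -- classes; the endpoint of the edge xy in the other class represents that one.
    split-transversal : ∀ {t} → IsTransversal κ′ W′ R (A ∷ Cs′) t → ∃ (IsTransversal κ W R (A ∷ Cs))
    split-transversal {t} it with κ (t A) ≟ κ y
    ... | yes κtA≡κy = _ , restrict keep
      (extend A x R-sym x∈W κx≡A ¬Rx
        (extend (κ y) (t A) R-sym (W′⊆W (∈W (here refl))) κtA≡κy
          (λ c∈ _ → indep (here refl) (there c∈) (≢-sym (≢A c∈))) base))
      where
      open IsTransversal it
      keep : A ∷ Cs ⊆ A ∷ κ y ∷ Cs′
      keep (here eq) = here eq
      keep {c} (there p) with c ≟ κ y
      ... | yes eq = there (here eq)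
      ... | no neq = there (there (∈-filter⁺ ≢κy? p neq))
      κ′≡⇒κ≡ : ∀ {v c} → κ′ v ≡ c → c ≢ A → κ v ≡ c
      κ′≡⇒κ≡ {v} eq c≢A with κ v ≟ κ y
      ... | yes _ = contradiction (sym eq) c≢A
      ... | no _  = eq
      base : IsTransversal κ W R Cs′ t
      base = record { ∈W = W′⊆W ∘ ∈W ∘ there
                    ; class = λ c∈ → κ′≡⇒κ≡ (class (there c∈)) (≢A c∈)
                    ; indep = λ p q → indep (there p) (there q) }
      ¬Rx : ∀ {c} → c ∈ κ y ∷ Cs′ → c ≢ A → ¬ R x (update t (κ y) (t A) c)
      ¬Rx {c} c∈ _ with c ≟ κ y | c∈
      ... | yes _ | _ = proj₁ (far (∈W (here refl))) ∘ R-sym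
      ... | no ≢κy | here eq = contradiction eq ≢κy
      ... | no _ | there p = proj₁ (far (∈W (there p))) ∘ R-sym
    ... | no κtA≢κy = _ , restrict keep
      (extend (κ y) y R-sym y∈W refl (λ c∈ _ → proj₂ (far (∈W c∈)) ∘ R-sym) base)
      where
      open IsTransversal it
      keep : A ∷ Cs ⊆ κ y ∷ A ∷ Cs′
      keep (here eq) = there (here eq)
      keep {c} (there p) with c ≟ κ y
      ... | yes eq = here eq
      ... | no neq = there (there (∈-filter⁺ ≢κy? p neq))
      class′ : ∀ {c} → c ∈ A ∷ Cs′ → κ (t c) ≡ c
      class′ (here refl) = trans (sym (κ′-≢ κtA≢κy)) (class (here refl))
      -- A representative in the class of `y` would carry the merged label `A`, which is not in
      -- `Cs′`.
      class′ {c} (there c∈) with κ (t c) ≟ κ y | class (there c∈)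
      ... | yes _ | eq = contradiction (subst (_∈ Cs′) (sym eq) c∈) A∉Cs′
      ... | no _  | eq = eq
      base : IsTransversal κ W R (A ∷ Cs′) t
      base = record { ∈W = W′⊆W ∘ ∈W ; class = class′ ; indep = indep }

    -- Vertices deleted from `W` are adjacent to `x` or `y`; the others lie in `W′`, where `Z`
    -- dominates them. One more class pays for two more dominating vertices.
    split-dominated : Dominated κ′ W′ R Cs′ → Dominated κ W R Cs
    split-dominated d = record
      { S = κ y ∷ S
      ; Z = x ∷ y ∷ Z
      ; S⊆Cs = λ { (here refl) → κy∈Cs ; (there p) → Cs′⊆Cs (S⊆Cs p) }
      ; unique = All.tabulate (λ p → ≢-sym (∈Cs′⇒≢ (S⊆Cs p))) ∷ unique
      ; Z-small = subst (suc (suc (length Z)) ≤_) (sym (ℕ.*-suc 2 (length S))) (s≤s (s≤s Z-small))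
      ; dominates = dominates′
      }
      where
      open Dominated d
      in-merged : ∀ {v} → κ v ∈ A ∷ κ y ∷ S → κ′ v ∈ A ∷ S
      in-merged {v} p with κ v ≟ κ y | p
      ... | yes _  | _                 = here refl
      ... | no _   | here eq           = here eq
      ... | no neq | there (here eq)   = contradiction eq neq
      ... | no _   | there (there κv∈) = there κv∈
      dominates′ : ∀ {v} → v ∈ W → κ v ∈ A ∷ κ y ∷ S → Any (R v) (x ∷ y ∷ Z)
      dominates′ {v} v∈W κv∈ with R? v x | R? v y
      ... | yes r | _     = here r
      ... | no _  | yes r = there (here r)
      ... | no ¬x | no ¬y = there (there (dominates (∈-filter⁺ far? v∈W (¬x , ¬y)) (in-merged κv∈)))

    split : Outcome κ′ W′ R Cs′ → Outcome κ W R Cs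
    split = Sum.map (λ (_ , it) → split-transversal it) split-dominated

  -- The restored edge can only spoil a transversal that contains both its ends. As `x` lies in
  -- class `A`, it must then represent `A`, and `y` its own class.
  ∖-transversal : ∀ {κ W R Cs s x y} → κ x ≡ A → IsTransversal κ W (R ∖[ x , y ]) (A ∷ Cs) s →
    ¬ (s A ≡ x × κ y ∈ Cs × s (κ y) ≡ y) → IsTransversal κ W R (A ∷ Cs) s
  ∖-transversal {κ} {Cs = Cs} {s} {x} {y} κx≡A is ¬xy = record
    { ∈W = ∈W ; class = class ; indep = indep′ }
    where
    open IsTransversal is
    ¬endpoints : ∀ {c c′} → c ∈ A ∷ Cs → c′ ∈ A ∷ Cs → c ≢ c′ → ¬ (s c ≡ x × s c′ ≡ y)
    ¬endpoints {c} {c′} c∈ c′∈ c≢c′ (sc≡x , sc′≡y) with c′∈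
    ... | here c′≡A = c≢c′ (trans c≡A (sym c′≡A))
      where c≡A = trans (sym (class c∈)) (trans (cong κ sc≡x) κx≡A)
    ... | there p = ¬xy
      ( trans (cong s (sym c≡A)) sc≡x
      , subst (_∈ Cs) c′≡κy p
      , trans (cong s (sym c′≡κy)) sc′≡y)
      where
      c≡A = trans (sym (class c∈)) (trans (cong κ sc≡x) κx≡A)
      c′≡κy = trans (sym (class c′∈)) (cong κ sc′≡y)
    indep′ : ∀ {c c′} → c ∈ A ∷ Cs → c′ ∈ A ∷ Cs → c ≢ c′ → ¬ _
    indep′ p q c≢c′ r = indep p q c≢c′
      (r , ¬endpoints p q c≢c′ , λ (e , e′) → ¬endpoints q p (≢-sym c≢c′) (e′ , e))

  -- Induction on a list `F` covering the edges that leave class `A`. Once no such edge is left, any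
  -- vertex `a` of that class can be added.
  haxell-edges : ∀ {m} → HaxellFor m → ∀ F {κ : V → C} {W R Cs t a} → length Cs ≤ m → A ∉ Cs →
    Symmetric R → Decidable R → a ∈ W → κ a ≡ A →
    (∀ {u v} → u ∈ W → v ∈ W → R u v → κ u ≡ A → (u , v) ∈ F) →
    IsTransversal κ W R Cs t → Outcome κ W R Cs
  haxell-edges rec [] {a = a} _ A∉Cs R-sym R? a∈W κa≡A covers it =
    inj₁ (_ , extend A a R-sym a∈W κa≡A
      (λ c∈ _ r → contradiction (covers a∈W (∈W c∈) r κa≡A) λ ()) it)
    where open IsTransversal it
  haxell-edges {m} rec ((x , y) ∷ F) {κ} {W} {R} {Cs} {t} {a} Cs≤m A∉Cs R-sym R? a∈W κa≡A covers it
    with κ x ≟ A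
  ... | no κx≢A = haxell-edges rec F Cs≤m A∉Cs R-sym R? a∈W κa≡A covers′ it
    where
    covers′ : ∀ {u v} → u ∈ W → v ∈ W → R u v → κ u ≡ A → (u , v) ∈ F
    covers′ u∈W v∈W r κu≡A with covers u∈W v∈W r κu≡A
    ... | here refl = contradiction κu≡A κx≢A
    ... | there p   = p
  ... | yes κx≡A with haxell-edges rec F {R = R ∖[ x , y ]} Cs≤m A∉Cs
                        (∖-sym R-sym) (∖-dec R? x y) a∈W κa≡A covers′ it′
    where
    open IsTransversal it
    covers′ : ∀ {u v} → u ∈ W → v ∈ W → (R ∖[ x , y ]) u v → κ u ≡ A → (u , v) ∈ F
    covers′ u∈W v∈W (r , ≢xy , _) κu≡A with covers u∈W v∈W r κu≡A
    ... | here refl = contradiction (refl , refl) ≢xy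
    ... | there p   = p
    it′ : IsTransversal κ W (R ∖[ x , y ]) Cs t
    it′ = record { ∈W = ∈W ; class = class ; indep = λ p q c≢c′ → indep p q c≢c′ ∘ proj₁ }
  -- Restoring an edge cannot destroy domination.
  ...   | inj₂ dom = inj₂ (Dominated-mono proj₁ dom)
  ...   | inj₁ (s , is) with s A ≟ᵛ x ×-dec κ y ∈? Cs ×-dec s (κ y) ≟ᵛ y
  ...     | no  ¬xy = inj₁ (s , ∖-transversal κx≡A is ¬xy)
  -- The edge `xy` spoils `s`. Merging removes one class, so the induction on classes applies, with
  -- the rest of `s` as the partial transversal it starts from.
  ...     | yes (sA≡x , κy∈Cs , sy≡y) =
    split (rec (ℕ.≤-trans Cs′-shorter Cs≤m) A∉Cs′ R-sym R? (merged-transversal is sA≡x sy≡y))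
    where
    open IsTransversal is
    open Merge A∉Cs R-sym R? (subst (_∈ W) sA≡x (∈W (here refl)))
           (subst (_∈ W) sy≡y (∈W (there κy∈Cs))) κx≡A κy∈Cs

  haxell : ∀ m → HaxellFor m
  haxell (suc m) {κ} {W} (s≤s Cs≤m) A∉Cs R-sym R? it with any? (λ v → κ v ≟ A) W
  ... | yes A-vertex with a , a∈W , κa≡A ← find A-vertex =
    haxell-edges (haxell m) (cartesianProduct W W) Cs≤m A∉Cs R-sym R? a∈W κa≡A
      (λ u∈W v∈W _ _ → ∈-cartesianProduct⁺ u∈W v∈W) it
  -- An empty class `A` is dominated by the empty set.
  ... | no none = inj₂ record
    { S = [] ; Z = [] ; S⊆Cs = λ () ; unique = [] ; Z-small = z≤n
    ; dominates = λ { v∈W (here κv≡A) → contradiction (lose v∈W κv≡A) none } }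

-- Counting in lists.

module ListCounting where

  open import Data.Nat using (_+_; _*_; _≤_; _<_)

  module _ {X : Set} (_≟ˣ_ : DecidableEquality X) where

    -- Pigeonhole: each entry of `xs` uses up an entry of `ys`, which is then filtered out.
    unique⇒length-≤ : ∀ {xs ys : List X} → Unique xs → xs ⊆ ys → length xs ≤ length ys
    unique⇒length-≤ {[]} _ _ = z≤n
    unique⇒length-≤ {x ∷ xs} {ys} (x∉xs ∷ xs!) xs⊆ys = ℕ.≤-<-trans
      (unique⇒length-≤ xs! λ p → ∈-filter⁺ ≢x? (xs⊆ys (there p)) (≢-sym (All.lookup x∉xs p)))
      (filter-notAll ≢x? ys (Any.map (λ eq neq → neq (sym eq)) (xs⊆ys (here refl))))
      where ≢x? = λ y → ¬? (y ≟ˣ x)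

    length-without : ∀ x {xs} → Unique xs → length xs ≤ suc (length (filter (λ y → ¬? (y ≟ˣ x)) xs))
    length-without x {xs} xs! = unique⇒length-≤ {ys = x ∷ filter (λ y → ¬? (y ≟ˣ x)) xs} xs! keep
      where
      keep : xs ⊆ x ∷ filter (λ y → ¬? (y ≟ˣ x)) xs
      keep {y} p with y ≟ˣ x
      ... | yes eq = here eq
      ... | no neq = there (∈-filter⁺ (λ y → ¬? (y ≟ˣ x)) p neq)

  length-filter-+-¬ : ∀ {X : Set} {P : Pred X 0ℓ} (P? : Unary.Decidable P) xs →
    length (filter P? xs) + length (filter (¬? ∘ P?) xs) ≡ length xs
  length-filter-+-¬ P? [] = refl
  length-filter-+-¬ P? (x ∷ xs) with does (P? x)
  ... | true  = cong suc (length-filter-+-¬ P? xs)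
  ... | false = trans (ℕ.+-suc (length (filter P? xs)) _) (cong suc (length-filter-+-¬ P? xs))

  nonempty⇒∃∈ : ∀ {X : Set} {xs : List X} → 0 < length xs → ∃ (_∈ xs)
  nonempty⇒∃∈ {xs = x ∷ _} _ = x , here refl

  module _ {X Y : Set} (f : X → List Y) {m : ℕ} where

    length-concatMap-≤ : ∀ xs → (∀ {x} → x ∈ xs → length (f x) ≤ m) →
      length (concatMap f xs) ≤ length xs * m
    length-concatMap-≤ []       _  = z≤n
    length-concatMap-≤ (x ∷ xs) ub = subst (_≤ m + length xs * m) (sym (length-++ (f x)))
      (ℕ.+-mono-≤ (ub (here refl)) (length-concatMap-≤ xs (ub ∘ there)))

    length-concatMap-≥ : ∀ xs → (∀ {x} → x ∈ xs → m ≤ length (f x)) →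
      length xs * m ≤ length (concatMap f xs)
    length-concatMap-≥ []       _  = z≤n
    length-concatMap-≥ (x ∷ xs) lb = subst (m + length xs * m ≤_) (sym (length-++ (f x)))
      (ℕ.+-mono-≤ (lb (here refl)) (length-concatMap-≥ xs (lb ∘ there)))

-- Partial list colourings and colour degrees.

module ListColouring {n} (G : Graph n) where

  open import Data.Nat using (_+_; _*_; _≤_; _<_; _≟_; _<?_; _≤?_)
  open import Data.List.Membership.DecPropositional _≟_ using (_∈?_)
  open ListCounting

  -- `f` is total but constrained only on the uncoloured set `Us`, so the set can shrink from round
  -- to round.
  ColoursOn : List (Fin n) → ListAssignment n → (Fin n → ℕ) → Set
  ColoursOn Us L f =
    (∀ {u} → u ∈ Us → f u ∈ L u) ×
    (∀ {u v} → u ∈ Us → v ∈ Us → adj G u v ≡ true → f u ≢ f v)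

  neighbour? : (L : ListAssignment n) (v : Fin n) (c : ℕ) →
    Unary.Decidable (λ u → adj G v u ≡ true × c ∈ L u)
  neighbour? L v c u = adj G v u Bool.≟ true ×-dec c ∈? L u

  -- Its length is the colour degree of `c` at `v`; `v` may lie outside `Us` and may lack `c` in its
  -- own list.
  neighbours : List (Fin n) → ListAssignment n → Fin n → ℕ → List (Fin n)
  neighbours Us L v c = filter (neighbour? L v c) Us

  -- Colouring by Haxell's theorem when all colour degrees are at most `d`.

  module SmallColourDegrees (d : ℕ) (Us : List (Fin n)) (L : ListAssignment n)
    (L-unique : ∀ {u} → u ∈ Us → Unique (L u)) (L-large : ∀ {u} → u ∈ Us → 2 * d < length (L u))
    (small : ∀ v c → length (neighbours Us L v c) ≤ d) where

    choices : Fin n → List (Fin n × ℕ)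
    choices u = map (u ,_) (L u)

    choices-large : ∀ {u} → u ∈ Us → 2 * d < length (choices u)
    choices-large {u} u∈ = subst (2 * d <_) (sym (length-map (u ,_) (L u))) (L-large u∈)

    clashes : Fin n × ℕ → List (Fin n × ℕ)
    clashes (v , c) = map (_, c) (neighbours Us L v c)

    clashes-small : ∀ v c → length (clashes (v , c)) ≤ d
    clashes-small v c = subst (_≤ d) (sym (length-map (_, c) (neighbours Us L v c))) (small v c)

    W : List (Fin n × ℕ)
    W = concatMap choices Us

    -- In this auxiliary graph on pairs (vertex, listed colour), classed by vertex, an independent
    -- transversal is a proper list colouring.
    Conflict : Rel (Fin n × ℕ) 0ℓ
    Conflict (u , c) (v , c′) = adj G u v ≡ true × c ≡ c′

    Conflict-sym : Symmetric Conflict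
    Conflict-sym {u , _} {v , _} (uv , refl) = trans (adj-sym G v u) uv , refl

    Conflict? : Decidable Conflict
    Conflict? (u , c) (v , c′) = adj G u v Bool.≟ true ×-dec c ≟ c′

    _≟ᵖ_ : DecidableEquality (Fin n × ℕ)
    _≟ᵖ_ = ≡-dec Fin._≟_ _≟_

    ∈-choices⁻ : ∀ {vs x} → x ∈ concatMap choices vs → proj₁ x ∈ vs × proj₂ x ∈ L (proj₁ x)
    ∈-choices⁻ {vs} x∈ with find (∈-concatMap⁻ choices {xs = vs} x∈)
    ... | u , u∈vs , x∈u with ∈-map⁻ (u ,_) x∈u
    ...   | _ , c∈L , refl = u∈vs , c∈L

    ∈-choices⁺ : ∀ {vs u c} → u ∈ vs → c ∈ L u → (u , c) ∈ concatMap choices vs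
    ∈-choices⁺ {u = u} u∈vs c∈L = ∈-concatMap⁺ choices (lose u∈vs (∈-map⁺ (u ,_) c∈L))

    choices-unique : ∀ {vs} → vs ⊆ Us → Unique vs → Unique (concatMap choices vs)
    choices-unique {vs} vs⊆Us vs! = Unique.concat⁺
      (All.map⁺ (All.tabulate λ u∈ → Unique.map⁺ (cong proj₂) (L-unique (vs⊆Us u∈))))
      (AllPairs.map⁺ (AllPairs.map disjoint vs!))
      where
      disjoint : ∀ {u v} → u ≢ v → Disjoint (choices u) (choices v)
      disjoint {u} {v} u≢v (p , q) with ∈-map⁻ (u ,_) p | ∈-map⁻ (v ,_) q
      ... | _ , _ , refl | _ , _ , refl = u≢v refl

    module Extension (A : Fin n) where
      open Transversals _≟ᵖ_ Fin._≟_ A public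

      -- With s the length of `S`, the s + 1 classes hold at least (s + 1)(2d + 1) pairs, but 2s
      -- pairs with at most `d` conflicts each dominate at most 2sd.
      ¬dominated : ∀ {Cs} → A ∈ Us → A ∉ Cs → Cs ⊆ Us → ¬ Dominated proj₁ W Conflict Cs
      ¬dominated {Cs} A∈Us A∉Cs Cs⊆Us dom = ℕ.<-irrefl refl (begin-strict
        length X
          ≤⟨ unique⇒length-≤ _≟ᵖ_ (choices-unique AS⊆Us AS-unique) X⊆Y ⟩
        length Y
          ≤⟨ length-concatMap-≤ clashes Z (λ {(v , c)} _ → clashes-small v c) ⟩
        length Z * d
          ≤⟨ ℕ.*-monoˡ-≤ d Z-small ⟩
        2 * length S * d
          ≡⟨ trans (cong (_* d) (ℕ.*-comm 2 (length S))) (ℕ.*-assoc (length S) 2 d) ⟩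
        length S * (2 * d)
          ≤⟨ ℕ.*-monoʳ-≤ (length S) (ℕ.n≤1+n (2 * d)) ⟩
        length S * suc (2 * d)
          <⟨ ℕ.m<n+m (length S * suc (2 * d)) (s≤s z≤n) ⟩
        length (A ∷ S) * suc (2 * d)
          ≤⟨ length-concatMap-≥ choices (A ∷ S) (choices-large ∘ AS⊆Us) ⟩
        length X ∎)
        where
        open ℕ.≤-Reasoning
        open Dominated dom
        X = concatMap choices (A ∷ S)
        Y = concatMap clashes Z
        AS⊆Us : A ∷ S ⊆ Us
        AS⊆Us (here refl) = A∈Us
        AS⊆Us (there p)   = Cs⊆Us (S⊆Cs p)
        AS-unique : Unique (A ∷ S)
        AS-unique = All.tabulate (λ { p refl → A∉Cs (S⊆Cs p) }) ∷ unique
        X⊆Y : X ⊆ Y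
        X⊆Y {u , c} x∈X with u∈AS , c∈L ← ∈-choices⁻ {A ∷ S} x∈X
          = ∈-concatMap⁺ clashes
              (Any.map dominated-by (dominates (∈-choices⁺ (AS⊆Us u∈AS) c∈L) u∈AS))
          where
          dominated-by : ∀ {z} → Conflict (u , c) z → (u , c) ∈ clashes z
          dominated-by {v , _} (uv , refl) =
            ∈-map⁺ (_, c)
              (∈-filter⁺ (neighbour? L v c) (AS⊆Us u∈AS) (trans (adj-sym G v u) uv , c∈L))

    transversal : ∀ Cs → Cs ⊆ Us → Unique Cs → ∃ (IsTransversal proj₁ W Conflict Cs)
    -- No class has to be represented yet; the colour 0 is a dummy.
    transversal [] _ _ = (_, 0) , record { ∈W = λ () ; class = λ () ; indep = λ () }
    transversal (A ∷ Cs) ACs⊆Us (A∉Cs ∷ Cs!)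
      with _ , it ← transversal Cs (ACs⊆Us ∘ there) Cs!
      with Extension.haxell A _ ℕ.≤-refl (All.All¬⇒¬Any A∉Cs)
             (λ {x} {y} → Conflict-sym {x} {y}) Conflict? it
    ... | inj₁ transversal′ = transversal′
    ... | inj₂ dom = contradiction dom
            (Extension.¬dominated A (ACs⊆Us (here refl)) (All.All¬⇒¬Any A∉Cs) (ACs⊆Us ∘ there))

    colourable : Unique Us → ∃ (ColoursOn Us L)
    colourable Us! with t , it ← transversal Us (λ p → p) Us!
      = proj₂ ∘ t , colour∈ , proper
      where
      open IsTransversal it
      colour∈ : ∀ {u} → u ∈ Us → proj₂ (t u) ∈ L u
      colour∈ {u} u∈ = subst (λ v → proj₂ (t u) ∈ L v) (class u∈) (proj₂ (∈-choices⁻ {Us} (∈W u∈)))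
      proper : ∀ {u v} → u ∈ Us → v ∈ Us → adj G u v ≡ true → proj₂ (t u) ≢ proj₂ (t v)
      -- Independence speaks of distinct classes only; irreflexivity excludes `u` = `v`.
      proper {u} {v} u∈ v∈ uv eq with u Fin.≟ v
      ... | yes refl = contradiction (trans (sym uv) (adj-irrefl G u)) λ ()
      ... | no u≢v   = indep u∈ v∈ u≢v (adj-t , eq)
        where
        adj-t : adj G (proj₁ (t u)) (proj₁ (t v)) ≡ true
        adj-t rewrite class u∈ | class v∈ = uv

  -- Greedy rounds that remove large colour degrees.

  module Greedy (triangle-free : TriangleFree G) (d : ℕ) where

    -- Each round spends one colour and removes more than d vertices; q bounds the number of rounds.
    colourable : ∀ q Us L → Unique Us → (∀ {u} → u ∈ Us → Unique (L u)) →
      (∀ {u} → u ∈ Us → 2 * d + q < length (L u)) → length Us < suc d * suc q → ∃ (ColoursOn Us L)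
    colourable q Us L Us! L-unique L-large Us-small
      with any? (λ v → any? (λ c → d <? length (neighbours Us L v c)) (concatMap L Us)) (allFin n)
    ... | no none = SmallColourDegrees.colourable d Us L L-unique
                      (λ u∈ → ℕ.≤-<-trans (ℕ.m≤m+n (2 * d) q) (L-large u∈)) small Us!
      where
      small : ∀ v c → length (neighbours Us L v c) ≤ d
      small v c with length (neighbours Us L v c) ≤? d
      ... | yes le = le
      -- The search ran only over colours listed on `Us`; a colour of positive degree is on the list
      -- of some neighbour, so it was covered.
      ... | no nle with u , u∈N ← nonempty⇒∃∈ (ℕ.≤-<-trans z≤n (ℕ.≰⇒> nle))
                   with u∈Us , _ , c∈L ← ∈-filter⁻ (neighbour? L v c) {xs = Us} u∈N
        = contradiction (lose (∈-allFin v) (lose (∈-concatMap⁺ L (lose u∈Us c∈L)) (ℕ.≰⇒> nle))) none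
    ... | yes big with v , _ , big-v ← find big with c , _ , d<N ← find big-v =
      round q L-large Us-small
      where
      nb? = neighbour? L v c
      Us′ = filter (¬? ∘ nb?) Us
      ≢c? = λ c′ → ¬? (c′ ≟ c)
      L′ = λ u → filter ≢c? (L u)
      Us′⊆Us : Us′ ⊆ Us
      Us′⊆Us = proj₁ ∘ ∈-filter⁻ (¬? ∘ nb?) {xs = Us}
      extend-colouring : ∃ (ColoursOn Us′ L′) → ∃ (ColoursOn Us L)
      extend-colouring (f′ , f′∈L′ , f′-proper) = f , f∈L , f-proper
        where
        f : Fin n → ℕ
        f u with nb? u
        ... | yes _ = c
        ... | no _  = f′ u
        f∈L : ∀ {u} → u ∈ Us → f u ∈ L u
        f∈L {u} u∈ with nb? u
        ... | yes (_ , c∈L) = c∈L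
        ... | no ¬nb        = proj₁ (∈-filter⁻ ≢c? {xs = L u} (f′∈L′ (∈-filter⁺ (¬? ∘ nb?) u∈ ¬nb)))
        f′≢c : ∀ {u} → u ∈ Us → ¬ (adj G v u ≡ true × c ∈ L u) → f′ u ≢ c
        f′≢c {u} u∈ ¬nb = proj₂ (∈-filter⁻ ≢c? {xs = L u} (f′∈L′ (∈-filter⁺ (¬? ∘ nb?) u∈ ¬nb)))
        f-proper : ∀ {u w} → u ∈ Us → w ∈ Us → adj G u w ≡ true → f u ≢ f w
        f-proper {u} {w} u∈ w∈ uw with nb? u | nb? w
        -- Two adjacent vertices that both receive `c` would form a triangle with `v`.
        ... | yes (vu , _) | yes (vw , _) = contradiction (v , u , w , vu , uw , vw) triangle-free
        ... | yes _        | no ¬nb       = ≢-sym (f′≢c w∈ ¬nb)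
        ... | no ¬nb       | yes _        = f′≢c u∈ ¬nb
        ... | no ¬nb       | no ¬nb′      =
          f′-proper (∈-filter⁺ (¬? ∘ nb?) u∈ ¬nb) (∈-filter⁺ (¬? ∘ nb?) w∈ ¬nb′) uw
      round : ∀ q → (∀ {u} → u ∈ Us → 2 * d + q < length (L u)) → length Us < suc d * suc q →
        ∃ (ColoursOn Us L)
      -- With no round left at most `d` vertices remain, too few for a neighbourhood of more than
      -- `d`.
      round zero _ Us-small = contradiction Us-small (ℕ.≤⇒≯ (begin
        suc d * 1                    ≡⟨ ℕ.*-identityʳ (suc d) ⟩
        suc d                        ≤⟨ d<N ⟩
        length (neighbours Us L v c) ≤⟨ length-filter nb? Us ⟩
        length Us                    ∎))
        where open ℕ.≤-Reasoning
      round (suc q) L-large Us-small = extend-colouring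
        (colourable q Us′ L′ (Unique.filter⁺ (¬? ∘ nb?) Us!)
          (Unique.filter⁺ ≢c? ∘ L-unique ∘ Us′⊆Us) L′-large Us′-small)
        where
        L′-large : ∀ {u} → u ∈ Us′ → 2 * d + q < length (L′ u)
        L′-large {u} u∈ = ℕ.≤-pred (begin-strict
          suc (2 * d + q)     ≡⟨ ℕ.+-suc (2 * d) q ⟨
          2 * d + suc q       <⟨ L-large (Us′⊆Us u∈) ⟩
          length (L u)        ≤⟨ length-without _≟_ c (L-unique (Us′⊆Us u∈)) ⟩
          suc (length (L′ u)) ∎)
          where open ℕ.≤-Reasoning
        Us′-small : length Us′ < suc d * suc q
        Us′-small = ℕ.+-cancelˡ-< (suc d) _ _ (begin-strict
          suc d + length Us′                        ≤⟨ ℕ.+-monoˡ-≤ (length Us′) d<N ⟩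
          length (neighbours Us L v c) + length Us′ ≡⟨ length-filter-+-¬ nb? Us ⟩
          length Us                                 <⟨ Us-small ⟩
          suc d * suc (suc q)                       ≡⟨ ℕ.*-suc (suc d) (suc q) ⟩
          suc d + suc d * suc q                     ∎)
          where open ℕ.≤-Reasoning

    -- Of the `2 * d + q + 1` colours, the rounds spend at most `q`, and the `2 * d + 1` left over
    -- suffice for Haxell's theorem.
    choosable : ∀ q → n < suc d * suc q → Choosable G (suc (2 * d + q))
    choosable q n< L isK with f , f∈L , proper ← colourable q (allFin n) L (Unique.allFin⁺ n)
        (λ {u} _ → proj₁ (isK u)) (λ {u} _ → proj₂ (isK u))
        (subst (_< suc d * suc q) (sym (length-tabulate {n = n} (λ i → i))) n<)
      = f , (λ v → f∈L (∈-allFin v)) , λ u v → proper (∈-allFin u) (∈-allFin v)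

-- Rational arithmetic for the bound.

open import Data.Rational using
  ( ℚ; mkℚ; 0ℚ; 1ℚ; _<_; _+_; _*_; _-_; _≤_; _/_; _≤?_; *≤*; ↧ₙ_
  ; Positive; NonNegative; positive; nonNegative)

-- The fraction `m / 1` is normalised by a gcd that is stuck on a variable `m`; the explicit form
-- computes.
ℕtoℚ-mkℚ : ∀ m → ℕtoℚ m ≡ mkℚ (+ m) 0 (Coprime.sym (Coprime.1-coprimeTo m))
ℕtoℚ-mkℚ m = ℚ.normalize-coprime (Coprime.sym (Coprime.1-coprimeTo m))

ℕtoℚ-homo-+ : ∀ m n → ℕtoℚ (m ℕ.+ n) ≡ ℕtoℚ m + ℕtoℚ n
ℕtoℚ-homo-+ m n rewrite ℕtoℚ-mkℚ m | ℕtoℚ-mkℚ n =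
  cong (_/ 1) (sym (cong₂ ℤ._+_ (ℤ.*-identityʳ (+ m)) (ℤ.*-identityʳ (+ n))))

ℕtoℚ-homo-* : ∀ m n → ℕtoℚ (m ℕ.* n) ≡ ℕtoℚ m * ℕtoℚ n
ℕtoℚ-homo-* m n rewrite ℕtoℚ-mkℚ m | ℕtoℚ-mkℚ n = cong (_/ 1) (ℤ.pos-* m n)

ℕtoℚ-mono-≤ : ∀ {m n} → m ℕ.≤ n → ℕtoℚ m ≤ ℕtoℚ n
ℕtoℚ-mono-≤ {m} {n} m≤n rewrite ℕtoℚ-mkℚ m | ℕtoℚ-mkℚ n = *≤* (ℤ.*-monoʳ-≤-nonNeg (+ 1) (ℤ.+≤+ m≤n))

-- The product is the numerator of `ε`, a positive integer.
1≤ε*denominator : ∀ ε .{{_ : Positive ε}} → 1ℚ ≤ ε * ℕtoℚ (↧ₙ ε)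
1≤ε*denominator ε@(mkℚ +[1+ p ] q-1 _) rewrite ℕtoℚ-mkℚ (suc q-1) = ℚ.toℚᵘ-cancel-≤
  (ℚᵘ.≤-respʳ-≃
    (ℚᵘ.≃-sym (ℚ.toℚᵘ-homo-* ε (mkℚ (+ q) 0 (Coprime.sym (Coprime.1-coprimeTo q)))))
    (ℚᵘ.*≤* (ℤ.+≤+ (ℕ.≤-trans (ℕ.≤-reflexive (rearrange q))
      (ℕ.*-monoˡ-≤ 1 (ℕ.m≤n*m q (suc p)))))))
  where
  q = suc q-1
  rearrange : ∀ q → 1 ℕ.* (q ℕ.* 1) ≡ q ℕ.* 1
  rearrange = solve-∀

*-mono-≤-nonNeg : ∀ {p q r s} → 0ℚ ≤ p → 0ℚ ≤ r → p ≤ q → r ≤ s → p * r ≤ q * s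
*-mono-≤-nonNeg {p} {q} {r} {s} 0≤p 0≤r p≤q r≤s = ℚ.≤-trans
  (ℚ.*-monoʳ-≤-nonNeg r {{nonNegative 0≤r}} p≤q)
  (ℚ.*-monoˡ-≤-nonNeg q {{nonNegative (ℚ.≤-trans 0≤p p≤q)}} r≤s)

-- For q the denominator of `ε`, εq ≥ 1, so n ≥ 16q² forces ε²n ≥ 16.
threshold : ℚ → ℕ
threshold ε = 16 ℕ.* (↧ₙ ε ℕ.* ↧ₙ ε)

16≤ε²n : ∀ ε .{{_ : Positive ε}} {n} → n ≥ threshold ε → ℕtoℚ 16 ≤ sq ε * ℕtoℚ n
16≤ε²n ε {n} n≥ = begin
  ℕtoℚ 16
    ≡⟨ solve 0 (con (ℕtoℚ 16) := con (ℕtoℚ 16) :* (con 1ℚ :* con 1ℚ)) refl ⟩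
  ℕtoℚ 16 * (1ℚ * 1ℚ)
    ≤⟨ ℚ.*-monoˡ-≤-nonNeg (ℕtoℚ 16) (*-mono-≤-nonNeg 0≤1 0≤1 1≤εQ 1≤εQ) ⟩
  ℕtoℚ 16 * ((ε * Q) * (ε * Q))
    ≡⟨ solve 3 (λ s ε Q → s :* ((ε :* Q) :* (ε :* Q)) := ε :* ε :* (s :* (Q :* Q)))
         refl (ℕtoℚ 16) ε Q ⟩
  sq ε * (ℕtoℚ 16 * (Q * Q))
    ≡⟨ cong (λ x → sq ε * (ℕtoℚ 16 * x)) (ℕtoℚ-homo-* (↧ₙ ε) (↧ₙ ε)) ⟨
  sq ε * (ℕtoℚ 16 * ℕtoℚ (↧ₙ ε ℕ.* ↧ₙ ε))
    ≡⟨ cong (sq ε *_) (ℕtoℚ-homo-* 16 (↧ₙ ε ℕ.* ↧ₙ ε)) ⟨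
  sq ε * ℕtoℚ (threshold ε)
    ≤⟨ ℚ.*-monoˡ-≤-nonNeg (sq ε) {{ℚ.pos⇒nonNeg (sq ε) {{ℚ.pos*pos⇒pos ε ε}}}}
         (ℕtoℚ-mono-≤ n≥) ⟩
  sq ε * ℕtoℚ n ∎
  where
  open ℚ.≤-Reasoning
  open +-*-Solver
  Q = ℕtoℚ (↧ₙ ε)
  1≤εQ = 1≤ε*denominator ε
  0≤1 : 0ℚ ≤ 1ℚ
  0≤1 = *≤* (ℤ.+≤+ z≤n)

-- Put E = ε²n. The hypothesis on `k` gives D ≤ 4k + E. If the first two disjuncts fail, then E ≤ k²
-- and D ≥ 0, so D² ≤ 16k² + 8kE + E². Here 16 ≤ E, 4 ≤ k and E ≤ k² bound the three terms by Ek²,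
-- 2Ek² and Ek², in total 4Ek².
bounded : ∀ ε .{{_ : Positive ε}} {n k} → n ≥ threshold ε → 4 ℕ.≤ k →
  k ℕ.* k ℕ.≤ 4 ℕ.* k ℕ.+ 8 ℕ.* n →
  BoundedBy2√2PlusEpsSqrt ε n k
bounded ε {n} {k} n≥ 4≤k k²≤
  with sq (ℕtoℚ k) ≤? sq ε * ℕtoℚ n | sq (ℕtoℚ k) + (sq ε - ℕtoℚ 8) * ℕtoℚ n ≤? 0ℚ
... | yes K≤E | _       = inj₁ K≤E
... | no _    | yes D≤0 = inj₂ (inj₁ D≤0)
... | no K≰E  | no D≰0  = inj₂ (inj₂ (begin
  sq D
    ≤⟨ *-mono-≤-nonNeg 0≤D 0≤D D≤B D≤B ⟩
  sq (f * κ + E)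
    ≡⟨ solve 3 (λ f κ E → (f :* κ :+ E) :* (f :* κ :+ E)
         := f :* f :* (κ :* κ) :+ (f :* κ :* E :+ f :* κ :* E) :+ E :* E) refl f κ E ⟩
  f * f * K + (f * κ * E + f * κ * E) + E * E
    ≤⟨ ℚ.+-mono-≤ (ℚ.+-mono-≤ 16K≤EK (ℚ.+-mono-≤ fκE≤KE fκE≤KE)) (ℚ.*-monoʳ-≤-nonNeg E E≤K) ⟩
  E * K + (K * E + K * E) + K * E
    ≡⟨ solve 3 (λ s K N → s :* N :* K :+ (K :* (s :* N) :+ K :* (s :* N)) :+ K :* (s :* N)
         := con (ℕtoℚ 4) :* s :* K :* N) refl (sq ε) K N ⟩
  f * sq ε * K * N ∎))
  where
  open ℚ.≤-Reasoning
  open +-*-Solver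
  f = ℕtoℚ 4
  κ = ℕtoℚ k
  K = sq κ
  N = ℕtoℚ n
  E = sq ε * N
  D = K + (sq ε - ℕtoℚ 8) * N
  0≤D : 0ℚ ≤ D
  0≤D = ℚ.<⇒≤ (ℚ.≰⇒> D≰0)
  E≤K : E ≤ K
  E≤K = ℚ.<⇒≤ (ℚ.≰⇒> K≰E)
  16≤E : ℕtoℚ 16 ≤ E
  16≤E = 16≤ε²n ε n≥
  instance
    κ-nonNeg : NonNegative κ
    κ-nonNeg = nonNegative (ℕtoℚ-mono-≤ {0} {k} z≤n)
    E-nonNeg : NonNegative E
    E-nonNeg = nonNegative (ℚ.≤-trans (ℕtoℚ-mono-≤ {0} {16} z≤n) 16≤E)
    K-nonNeg : NonNegative K
    K-nonNeg = nonNegative (ℚ.≤-trans (ℚ.nonNegative⁻¹ E) E≤K)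
  16K≤EK : f * f * K ≤ E * K
  16K≤EK = ℚ.*-monoʳ-≤-nonNeg K 16≤E
  fκE≤KE : f * κ * E ≤ K * E
  fκE≤KE = ℚ.*-monoʳ-≤-nonNeg E (ℚ.*-monoʳ-≤-nonNeg κ (ℕtoℚ-mono-≤ 4≤k))
  K≤ : K ≤ f * κ + ℕtoℚ 8 * N
  K≤ = begin
    K                                   ≡⟨ ℕtoℚ-homo-* k k ⟨
    ℕtoℚ (k ℕ.* k)                      ≤⟨ ℕtoℚ-mono-≤ k²≤ ⟩
    ℕtoℚ (4 ℕ.* k ℕ.+ 8 ℕ.* n)          ≡⟨ ℕtoℚ-homo-+ (4 ℕ.* k) (8 ℕ.* n) ⟩
    ℕtoℚ (4 ℕ.* k) + ℕtoℚ (8 ℕ.* n)     ≡⟨ cong₂ _+_ (ℕtoℚ-homo-* 4 k) (ℕtoℚ-homo-* 8 n) ⟩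
    f * κ + ℕtoℚ 8 * N                  ∎
  D≤B : D ≤ f * κ + E
  D≤B = begin
    D
      ≤⟨ ℚ.+-monoˡ-≤ ((sq ε - ℕtoℚ 8) * N) K≤ ⟩
    f * κ + ℕtoℚ 8 * N + (sq ε - ℕtoℚ 8) * N
      ≡⟨ solve 4 (λ a e s N → a :+ e :* N :+ (s :- e) :* N := a :+ s :* N)
           refl (f * κ) (ℕtoℚ 8) (sq ε) N ⟩
    f * κ + E ∎

-- Choice of `d` and of the list size.

⌊√[n/2]⌋ : ∀ n → ∃ λ d → 2 ℕ.* (d ℕ.* d) ℕ.≤ n × n ℕ.< 2 ℕ.* (suc d ℕ.* suc d)
⌊√[n/2]⌋ zero = 0 , z≤n , s≤s z≤n
⌊√[n/2]⌋ (suc n) with d , lower , upper ← ⌊√[n/2]⌋ n with suc n ℕ.<? 2 ℕ.* (suc d ℕ.* suc d)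
... | yes small = d , ℕ.m≤n⇒m≤1+n lower , small
... | no ¬small = suc d , ℕ.≮⇒≥ ¬small , ℕ.≤-<-trans upper
                    (ℕ.*-monoʳ-< 2 (ℕ.*-mono-< (ℕ.n<1+n (suc d)) (ℕ.n<1+n (suc d))))

theorem6p4 : (ε : ℚ) → 0ℚ < ε →
    Σ ℕ λ n₀ → (n : ℕ) → n ≥ n₀ → (G : Graph n) → TriangleFree G →
    Σ ℕ λ k → Choosable G k × BoundedBy2√2PlusEpsSqrt ε n k
theorem6p4 ε 0<ε = threshold ε , λ n n≥ G triangle-free →
  let d , lower , upper = ⌊√[n/2]⌋ n in
  k d ,
  -- With q = 2d + 1 rounds, (d + 1)(q + 1) = 2(d + 1)², which exceeds `n`. The list size becomes 4d
  -- + 2.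
  ListColouring.Greedy.choosable G triangle-free d (suc (2 ℕ.* d))
    (subst (n ℕ.<_) (factor d) upper) ,
  bounded ε {{positive 0<ε}} n≥ (4≤k d (ℕ.≤-<-trans (ℕ.≤-trans 2≤threshold n≥) upper)) (k²≤ d lower)
  where
  k : ℕ → ℕ
  k d = suc (2 ℕ.* d ℕ.+ suc (2 ℕ.* d))
  factor : ∀ d → 2 ℕ.* (suc d ℕ.* suc d) ≡ suc d ℕ.* suc (suc (2 ℕ.* d))
  factor = solve-∀
  2≤threshold : 2 ℕ.≤ threshold ε
  2≤threshold = ℕ.≤-trans (ℕ.m≤m+n 2 14) (ℕ.m≤m*n 16 (↧ₙ ε ℕ.* ↧ₙ ε))
  4≤k : ∀ d → 2 ℕ.< 2 ℕ.* (suc d ℕ.* suc d) → 4 ℕ.≤ k d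
  -- `d` = 0 would mean n < 2, below the threshold.
  4≤k zero    2<2 with () ← ℕ.<-irrefl refl 2<2
  4≤k (suc d) _   = subst (4 ℕ.≤_) (sym (k-suc d)) (ℕ.m≤m+n 4 (4 ℕ.* d ℕ.+ 2))
    where
    k-suc : ∀ d → suc (2 ℕ.* suc d ℕ.+ suc (2 ℕ.* suc d)) ≡ 4 ℕ.+ (4 ℕ.* d ℕ.+ 2)
    k-suc = solve-∀
  -- As k - 2 = 4d, the claim with 4 added on the left is (k - 2)² = 16d² ≤ 8n.
  k²≤ : ∀ d {n} → 2 ℕ.* (d ℕ.* d) ℕ.≤ n → k d ℕ.* k d ℕ.≤ 4 ℕ.* k d ℕ.+ 8 ℕ.* n
  k²≤ d {n} lower = begin
    k d ℕ.* k d                                  ≤⟨ ℕ.m≤m+n (k d ℕ.* k d) 4 ⟩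
    k d ℕ.* k d ℕ.+ 4                            ≡⟨ expand d ⟩
    4 ℕ.* k d ℕ.+ 8 ℕ.* (2 ℕ.* (d ℕ.* d))        ≤⟨ ℕ.+-monoʳ-≤ (4 ℕ.* k d) (ℕ.*-monoʳ-≤ 8 lower) ⟩
    4 ℕ.* k d ℕ.+ 8 ℕ.* n                        ∎
    where
    open ℕ.≤-Reasoning
    expand : ∀ d → suc (2 ℕ.* d ℕ.+ suc (2 ℕ.* d)) ℕ.* suc (2 ℕ.* d ℕ.+ suc (2 ℕ.* d)) ℕ.+ 4
      ≡ 4 ℕ.* suc (2 ℕ.* d ℕ.+ suc (2 ℕ.* d)) ℕ.+ 8 ℕ.* (2 ℕ.* (d ℕ.* d))
    expand = solve-∀
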